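{- Let $V$ be a finite set, $p:2^V\to\mathbb{Z}$ a fully supermodular function with $p(\emptyset)=0$, $f,g:V\to\mathbb{Z}$ with $f\le g$, $B=B'(p)$, and suppose $B^{\square}:=B\cap T(f,g)$ contains an integral point. Let $T\subseteq V$. Then there exist a box $T(f',g')\subseteq T(f,g)$ and a subset $X_T\subseteq V$ such that an element $m\in B^{\square}\cap\mathbb{Z}^V$ minimizes $\widetilde m(T)$ over $B^{\square}\cap\mathbb{Z}^V$ if and only if $\widetilde m(X_T)=p(X_T)$ and $m\in B\cap\mathbb{Z}^V\cap T(f',g')$.
   Context: $\widetilde x(Z)=\sum_{v\in Z}x(v)$; $B'(p)=\{x\in\mathbb{R}^V:\widetilde x(V)=p(V),\ \widetilde x(Z)\ge p(Z)\ \forall Z\subset V\}$; $T(f,g)=\{x\in\mathbb{R}^V:f\le x\le g\}$. Fully supermodular: $p(X)+p(Y)\le p(X\cap Y)+p(X\cup Y)$ for all $X,Y\subseteq V$. -}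

module Defs where

open import Data.Bool.Base using (if_then_else_)
open import Data.Fin.Base using (Fin)
open import Data.Fin.Subset using (Subset; ⊤; _∩_; _∪_)
open import Data.Integer.Base as ℤ using (ℤ)
open import Data.Nat.Base using (ℕ)
open import Data.Product.Base using (_×_; ∃-syntax)
open import Data.Rational.Base as ℚ using (ℚ; 0ℚ)
open import Data.Rational.Properties using (+-0-monoid)
open import Data.Vec.Base using (lookup)
open import Level using (0ℓ)
open import Relation.Binary.PropositionalEquality.Core using (_≡_)
open import Relation.Unary using (Pred; _∈_)

open import Algebra.Properties.Monoid.Sum +-0-monoid using (sum)

-- The ground set V is Fin n.  The standard library has no real numbers, so
-- the polyhedra, whose data are all integral, live in ℚ^V rather than ℝ^V.

Point : ℕ → Set
Point n = Fin n → ℚ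

ι : ℤ → ℚ
ι z = z ℚ./ 1

-- The set ℤ^V inside ℚ^V.
ℤ^V : ∀ {n} → Pred (Point n) 0ℓ
ℤ^V x = ∀ v → ∃[ z ] x v ≡ ι z

-- x̃(Z) = Σ_{v ∈ Z} x(v)
infix 8 _~_
_~_ : ∀ {n} → Point n → Subset n → ℚ
x ~ Z = sum (λ v → if lookup Z v then x v else 0ℚ)

FullySupermodular : ∀ {n} → (Subset n → ℤ) → Set
FullySupermodular p = ∀ X Y → p X ℤ.+ p Y ℤ.≤ p (X ∩ Y) ℤ.+ p (X ∪ Y)

-- The base polyhedron B'(p).
B′ : ∀ {n} → (Subset n → ℤ) → Pred (Point n) 0ℓ
B′ p x = (x ~ ⊤ ≡ ι (p ⊤)) × (∀ Z → ι (p Z) ℚ.≤ x ~ Z)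

-- The box T(f,g).
Box : ∀ {n} → (f g : Fin n → ℤ) → Pred (Point n) 0ℓ
Box f g x = ∀ v → (ι (f v) ℚ.≤ x v) × (x v ℚ.≤ ι (g v))

Minimizes : ∀ {n} → (Point n → ℚ) → Pred (Point n) 0ℓ → Pred (Point n) 0ℓ
Minimizes φ S m = (m ∈ S) × (∀ y → y ∈ S → φ m ℚ.≤ φ y)

{-# OPTIONS --safe #-}

-- Exchanging one unit from an element of T above its lower bound to an element
-- outside T below its upper bound decreases m(T), so after finitely many
-- exchanges a point m is reached where each such exchange leaves B′(p).  For
-- every such pair (s , t) there is then an m-tight set containing s but not t.
-- Tight sets form a lattice, so there is a single tight set X containing all
-- s ∈ T with f(s) < m(s) and no t ∉ T with m(t) < g(t).  For every y in the box,
--   y(T) = y(X) − y(X∖T) + y(T∖X) ≥ p(X) − g(X∖T) + f(T∖X),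
-- with equality iff X is y-tight, y = g on X∖T and y = f on T∖X; and m attains
-- equality.
module Submission where

open import Defs
open import Data.Bool.Base using (Bool; true; false; if_then_else_; _∧_; _∨_)
import Data.Bool.Properties as Bool
open import Data.Empty using (⊥-elim)
open import Data.Fin.Base using (Fin; zero; suc)
import Data.Fin.Properties as Fin
open import Data.Fin.Subset using (Subset; ⊥; ⊤) renaming (_∩_ to _∩ₛ_; _∪_ to _∪ₛ_)
open import Data.Fin.Subset.Properties using (anySubset?)
open import Data.Integer.Base as ℤ using (ℤ; 0ℤ; 1ℤ; _≤_; _<_; _+_; -_)
import Data.Integer.Properties as ℤ
open import Data.Integer.Tactic.RingSolver using (solve-∀)
open import Data.Nat.Base using (ℕ; zero; suc; z≤n)
open import Data.Nat.Coprimality as Coprime using (1-coprimeTo)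
open import Data.Product.Base using (_×_; _,_; ∃-syntax; proj₁; proj₂)
open import Data.Rational.Base as ℚ using (mkℚ; 0ℚ)
import Data.Rational.Properties as ℚ
open import Data.Vec.Base using (lookup)
open import Data.Vec.Properties using (lookup-zipWith; lookup-replicate)
open import Function.Base using (_∘_)
open import Function.Bundles using (_⇔_; mk⇔)
open import Relation.Binary.PropositionalEquality.Core using (_≡_; _≢_; refl; sym; trans; cong; cong₂; subst; subst₂)
open import Relation.Nullary using (¬_; Dec; yes; no; does)
open import Relation.Nullary.Decidable using (¬?; _×-dec_)
open import Relation.Unary using (_∈_; _∩_; _⊆_; Satisfiable)

open import Algebra.Properties.AbelianGroup ℤ.+-0-abelianGroup using (∙-cancelʳ)
open import Algebra.Properties.CommutativeMonoid.Sum ℤ.+-0-commutativeMonoid using (sum; ∑-distrib-+; sum-cong-≗)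
import Algebra.Properties.Monoid.Sum ℚ.+-0-monoid as ℚΣ

private
  variable
    n k : ℕ

-- Integer sums

sum-mono : ∀ {a b : Fin n → ℤ} → (∀ v → a v ≤ b v) → sum a ≤ sum b
sum-mono {zero}  a≤b = ℤ.≤-refl
sum-mono {suc n} a≤b = ℤ.+-mono-≤ (a≤b zero) (sum-mono (a≤b ∘ suc))

+-cancelʳ-≤ : ∀ c a b → a + c ≤ b + c → a ≤ b
+-cancelʳ-≤ c a b a+c≤b+c = ℤ.≮⇒≥ λ b<a → ℤ.<⇒≱ (ℤ.+-monoˡ-< c b<a) a+c≤b+c

-- Trading `d` for `c`, or `b` for `a`, before cancelling leaves the reverse of the other
-- inequality. Equality in a sum of inequalities thus passes to each summand; this serves both tight
-- sets and complementary slackness.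
+-mono-≤-squeeze : ∀ {a b c d} → a ≤ b → c ≤ d → b + d ≤ a + c → b ≤ a × d ≤ c
+-mono-≤-squeeze {a} {b} {c} {d} a≤b c≤d bd≤ac =
    +-cancelʳ-≤ c b a (ℤ.≤-trans (ℤ.+-monoʳ-≤ b c≤d) bd≤ac)
  , +-cancelʳ-≤ a d c (subst₂ ℤ._≤_ (ℤ.+-comm a d) (ℤ.+-comm a c) (ℤ.≤-trans (ℤ.+-monoˡ-≤ d a≤b) bd≤ac))

sum-mono-squeeze : ∀ {a b : Fin n → ℤ} → (∀ v → a v ≤ b v) → sum b ≤ sum a → ∀ v → b v ≤ a v
sum-mono-squeeze {suc n} a≤b Σb≤Σa v with +-mono-≤-squeeze (a≤b zero) (sum-mono (a≤b ∘ suc)) Σb≤Σa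
sum-mono-squeeze {suc n} a≤b Σb≤Σa zero    | b₀≤a₀ , _ = b₀≤a₀
sum-mono-squeeze {suc n} a≤b Σb≤Σa (suc v) | _ , tail≤ = sum-mono-squeeze (a≤b ∘ suc) tail≤ v

sum-zero : ∀ {a : Fin n → ℤ} → (∀ v → a v ≡ 0ℤ) → sum a ≡ 0ℤ
sum-zero {zero}  a≡0 = refl
sum-zero {suc n} a≡0 = cong₂ _+_ (a≡0 zero) (sum-zero (a≡0 ∘ suc))

sum-supported-at : ∀ (a : Fin n → ℤ) s → (∀ v → v ≢ s → a v ≡ 0ℤ) → sum a ≡ a s
sum-supported-at a zero a≡0 =
  trans (cong (a zero +_) (sum-zero λ v → a≡0 (suc v) λ ())) (ℤ.+-identityʳ _)
sum-supported-at a (suc s) a≡0 =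
  trans (cong₂ _+_ (a≡0 zero λ ()) (sum-supported-at (a ∘ suc) s λ v v≢s → a≡0 (suc v) (v≢s ∘ Fin.suc-injective)))
        (ℤ.+-identityˡ _)

-- Sums over subsets

restrict : (Fin n → ℤ) → Subset n → Fin n → ℤ
restrict x Z v = if lookup Z v then x v else 0ℤ

infix 8 _⟨_⟩
_⟨_⟩ : (Fin n → ℤ) → Subset n → ℤ
x ⟨ Z ⟩ = sum (restrict x Z)

⟨⟩-∩-∪ : ∀ (x : Fin n → ℤ) X Y → x ⟨ X ⟩ + x ⟨ Y ⟩ ≡ x ⟨ X ∩ₛ Y ⟩ + x ⟨ X ∪ₛ Y ⟩
⟨⟩-∩-∪ x X Y = trans (sym (∑-distrib-+ (restrict x X) (restrict x Y)))
  (trans (sum-cong-≗ pointwise) (∑-distrib-+ (restrict x (X ∩ₛ Y)) (restrict x (X ∪ₛ Y))))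
  where
  pointwise : ∀ v → restrict x X v + restrict x Y v ≡ restrict x (X ∩ₛ Y) v + restrict x (X ∪ₛ Y) v
  pointwise v rewrite lookup-zipWith _∧_ v X Y | lookup-zipWith _∨_ v X Y with lookup X v | lookup Y v
  ... | true  | true  = refl
  ... | true  | false = ℤ.+-comm (x v) 0ℤ
  ... | false | true  = refl
  ... | false | false = refl

⟨⟩-+ : ∀ (x y : Fin n → ℤ) Z → (λ v → x v + y v) ⟨ Z ⟩ ≡ x ⟨ Z ⟩ + y ⟨ Z ⟩
⟨⟩-+ x y Z = trans (sum-cong-≗ pointwise) (∑-distrib-+ (restrict x Z) (restrict y Z))
  where
  pointwise : ∀ v → restrict (λ v → x v + y v) Z v ≡ restrict x Z v + restrict y Z v
  pointwise v with lookup Z v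
  ... | true  = refl
  ... | false = refl

⟨⟩-cong : ∀ {x y : Fin n → ℤ} → (∀ v → x v ≡ y v) → ∀ Z → x ⟨ Z ⟩ ≡ y ⟨ Z ⟩
⟨⟩-cong x≡y Z = sum-cong-≗ λ v → cong (if lookup Z v then_else 0ℤ) (x≡y v)

⟨⊥⟩ : ∀ (x : Fin n → ℤ) → x ⟨ ⊥ ⟩ ≡ 0ℤ
⟨⊥⟩ x = sum-zero λ v → cong (if_then x v else 0ℤ) (lookup-replicate v false)

indicator : Bool → ℤ
indicator b = if b then 1ℤ else 0ℤ

unit : Fin n → Fin n → ℤ
unit s v = indicator (does (v Fin.≟ s))

unit⟨⟩ : ∀ (s : Fin n) Z → unit s ⟨ Z ⟩ ≡ indicator (lookup Z s)
unit⟨⟩ s Z = trans (sum-supported-at (restrict (unit s) Z) s off) at-s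
  where
  off : ∀ v → v ≢ s → restrict (unit s) Z v ≡ 0ℤ
  off v v≢s with lookup Z v | v Fin.≟ s
  ... | false | _       = refl
  ... | true  | yes v≡s = ⊥-elim (v≢s v≡s)
  ... | true  | no _    = refl
  at-s : restrict (unit s) Z s ≡ indicator (lookup Z s)
  at-s with lookup Z s | s Fin.≟ s
  ... | false | _      = refl
  ... | true  | yes _  = refl
  ... | true  | no s≢s = ⊥-elim (s≢s refl)

-- Integral points

Base : (Subset n → ℤ) → (Fin n → ℤ) → Set
Base p x = (x ⟨ ⊤ ⟩ ≡ p ⊤) × (∀ Z → p Z ≤ x ⟨ Z ⟩)

InBox : (f g : Fin n → ℤ) → (Fin n → ℤ) → Set
InBox f g x = ∀ v → (f v ≤ x v) × (x v ≤ g v)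

Tight : (Subset n → ℤ) → (Fin n → ℤ) → Subset n → Set
Tight p x Z = x ⟨ Z ⟩ ≡ p Z

-- Supermodularity of `p` and modularity of `x` give x(X ∩ Y) + x(X ∪ Y) ≤ p(X ∩ Y) + p(X ∪ Y). The
-- two base inequalities point the other way, so both hold with equality.
tight-lattice : ∀ {p : Subset n → ℤ} {x} → FullySupermodular p → Base p x → ∀ {X Y} →
                Tight p x X → Tight p x Y → Tight p x (X ∩ₛ Y) × Tight p x (X ∪ₛ Y)
tight-lattice {x = x} super (_ , p≤x) {X} {Y} tX tY =
  ℤ.≤-antisym (proj₁ squeezed) (p≤x _) , ℤ.≤-antisym (proj₂ squeezed) (p≤x _)
  where
  squeezed = +-mono-≤-squeeze (p≤x (X ∩ₛ Y)) (p≤x (X ∪ₛ Y))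
    (subst (ℤ._≤ _) (trans (sym (cong₂ _+_ tX tY)) (⟨⟩-∩-∪ x X Y)) (super X Y))

-- Moving one unit between two coordinates

exchange : (Fin n → ℤ) → (s t : Fin n) → Fin n → ℤ
exchange x s t v = (x v + unit t v) + - unit s v

-- The unit lost at `s` is kept on the left, so additivity of sums suffices and each use only has to
-- cancel known indicators.
exchange⟨⟩ : ∀ (x : Fin n → ℤ) s t Z →
             exchange x s t ⟨ Z ⟩ + indicator (lookup Z s) ≡ x ⟨ Z ⟩ + indicator (lookup Z t)
exchange⟨⟩ x s t Z =
  trans (cong (exchange x s t ⟨ Z ⟩ +_) (sym (unit⟨⟩ s Z)))
  (trans (sym (⟨⟩-+ (exchange x s t) (unit s) Z))
  (trans (⟨⟩-cong (λ v → cancel (x v + unit t v) (unit s v)) Z)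
  (trans (⟨⟩-+ x (unit t) Z) (cong (x ⟨ Z ⟩ +_) (unit⟨⟩ t Z)))))
  where
  cancel : ∀ a b → (a + - b) + b ≡ a
  cancel = solve-∀

Separates : (Subset n → ℤ) → (Fin n → ℤ) → (s t : Fin n) → Subset n → Set
Separates p x s t Z = Tight p x Z × lookup Z s ≡ true × lookup Z t ≡ false

separates? : ∀ (p : Subset n → ℤ) x s t Z → Dec (Separates p x s t Z)
separates? p x s t Z = (x ⟨ Z ⟩ ℤ.≟ p Z) ×-dec (lookup Z s Bool.≟ true) ×-dec (lookup Z t Bool.≟ false)

<⇒+1≤ : ∀ {a b} → a < b → a + 1ℤ ≤ b
<⇒+1≤ {a} a<b = subst (ℤ._≤ _) (ℤ.+-comm 1ℤ a) (ℤ.i<j⇒suc[i]≤j a<b)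

-- Only a set containing `s` but not `t` loses a unit. No such set is tight, so by integrality each
-- of them has slack at least one.
exchange-base : ∀ {p : Subset n → ℤ} {x s t} → Base p x →
                ¬ (∃[ Z ] Separates p x s t Z) → Base p (exchange x s t)
exchange-base {n} {p} {x} {s} {t} (x⊤≡ , p≤x) unseparated = total , λ Z →
  +-cancelʳ-≤ (indicator (lookup Z s)) _ _
    (subst (_ ℤ.≤_) (sym (exchange⟨⟩ x s t Z)) (bound Z _ _ refl refl))
  where
  total : exchange x s t ⟨ ⊤ ⟩ ≡ p ⊤
  total = trans (∙-cancelʳ 1ℤ _ _
    (subst₂ (λ b c → exchange x s t ⟨ ⊤ ⟩ + indicator b ≡ x ⟨ ⊤ ⟩ + indicator c)
      (lookup-replicate s true) (lookup-replicate t true) (exchange⟨⟩ x s t ⊤))) x⊤≡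
  bound : ∀ Z b c → lookup Z s ≡ b → lookup Z t ≡ c →
          p Z + indicator (lookup Z s) ≤ x ⟨ Z ⟩ + indicator (lookup Z t)
  bound Z true  true  eb ec rewrite eb | ec = ℤ.+-monoˡ-≤ 1ℤ (p≤x Z)
  bound Z false true  eb ec rewrite eb | ec = ℤ.+-mono-≤ (p≤x Z) (ℤ.+≤+ z≤n)
  bound Z false false eb ec rewrite eb | ec = ℤ.+-monoˡ-≤ 0ℤ (p≤x Z)
  bound Z true  false eb ec rewrite eb | ec | ℤ.+-identityʳ (x ⟨ Z ⟩) =
    <⇒+1≤ (ℤ.≤∧≢⇒< (p≤x Z) λ pZ≡xZ → unseparated (Z , sym pZ≡xZ , eb , ec))

-- Descent to a point where every improving exchange is blocked

Lowerable Raisable : (T : Subset n) (h x : Fin n → ℤ) → Fin n → Set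
Lowerable T f x s = lookup T s ≡ true  × f s < x s
Raisable  T g x t = lookup T t ≡ false × x t < g t

lowerable? : ∀ (T : Subset n) f x s → Dec (Lowerable T f x s)
lowerable? T f x s = (lookup T s Bool.≟ true) ×-dec (f s ℤ.<? x s)

raisable? : ∀ (T : Subset n) g x t → Dec (Raisable T g x t)
raisable? T g x t = (lookup T t Bool.≟ false) ×-dec (x t ℤ.<? g t)

-- Between integers a strict inequality leaves room for a whole unit. The points `s` and `t` differ,
-- since only `s` lies in `T`.
exchange-box : ∀ {f g x : Fin n → ℤ} {T s t} → InBox f g x →
               Lowerable T f x s → Raisable T g x t → InBox f g (exchange x s t)
exchange-box {f = f} {g} {x} {s = s} {t} box (Ts , fs<xs) (Tt , xt<gt) v with v Fin.≟ s | v Fin.≟ t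
... | yes refl | yes refl with () ← trans (sym Ts) Tt
exchange-box {f = f} {g} {x} {s = s} box (Ts , fs<xs) _ v | yes refl | no _
  rewrite ℤ.+-identityʳ (x s) =
    +-cancelʳ-≤ 1ℤ _ _ (subst (_ ℤ.≤_) (sym (cancel (x s))) (<⇒+1≤ fs<xs))
  , ℤ.≤-trans (ℤ.i-j≤i (x s) 1ℤ) (proj₂ (box s))
  where
  cancel : ∀ a → (a + - 1ℤ) + 1ℤ ≡ a
  cancel = solve-∀
exchange-box {x = x} {t = t} box _ (Tt , xt<gt) v | no _ | yes refl
  rewrite ℤ.+-identityʳ (x t + 1ℤ) =
    ℤ.≤-trans (proj₁ (box t)) (ℤ.i≤i+j (x t) 1ℤ)
  , <⇒+1≤ xt<gt
exchange-box {x = x} box _ _ v | no _ | no _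
  rewrite ℤ.+-identityʳ (x v + 0ℤ) | ℤ.+-identityʳ (x v) = box v

-- Local optimality with certificates: each improving exchange inside the box comes with a tight set
-- that would fall below `p`.
Blocked : (p : Subset n → ℤ) (f g : Fin n → ℤ) (T : Subset n) (x : Fin n → ℤ) → Set
Blocked p f g T x = ∀ s t → Lowerable T f x s → Raisable T g x t → ∃[ Z ] Separates p x s t Z

module _ (p : Subset n → ℤ) (f g : Fin n → ℤ) (T : Subset n) where

  -- Each exchange lowers x(T) by one, while x(T) ≥ p(T) for every base. The bound `k` on the gap
  -- therefore drives the recursion.
  blocked-below : ∀ k x → Base p x → InBox f g x → x ⟨ T ⟩ ≤ p T + ℤ.+ k →
                  ∃[ m ] Base p m × InBox f g m × Blocked p f g T m
  blocked-below k x base box x≤ with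
    Fin.any? (λ s → Fin.any? λ t →
      lowerable? T f x s ×-dec raisable? T g x t ×-dec ¬? (anySubset? (separates? p x s t)))
  ... | no none = x , base , box , blocked
    where
    blocked : Blocked p f g T x
    blocked s t ls rt with anySubset? (separates? p x s t)
    ... | yes separated  = separated
    ... | no unseparated = ⊥-elim (none (s , t , ls , rt , unseparated))
  ... | yes (s , t , ls , rt , unseparated) = descend k x≤
    where
    x′ = exchange x s t
    base′ : Base p x′
    base′ = exchange-base base unseparated
    decrease : x′ ⟨ T ⟩ + 1ℤ ≡ x ⟨ T ⟩
    decrease = trans
      (subst₂ (λ b c → x′ ⟨ T ⟩ + indicator b ≡ x ⟨ T ⟩ + indicator c) (proj₁ ls) (proj₁ rt) (exchange⟨⟩ x s t T))
      (ℤ.+-identityʳ _)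
    descend : ∀ k → x ⟨ T ⟩ ≤ p T + ℤ.+ k → ∃[ m ] Base p m × InBox f g m × Blocked p f g T m
    -- With gap zero the exchanged point would have x′(T) < p(T), contrary to `base′`.
    descend zero x≤ = ⊥-elim (ℤ.<⇒≱ (ℤ.suc[i]≤j⇒i<j
      (subst₂ ℤ._≤_ (trans (sym decrease) (ℤ.+-comm (x′ ⟨ T ⟩) 1ℤ)) (ℤ.+-identityʳ _) x≤)) (proj₂ base′ T))
    descend (suc k) x≤ = blocked-below k x′ base′ (exchange-box {T = T} box ls rt)
      (+-cancelʳ-≤ 1ℤ _ _ (subst₂ ℤ._≤_ (sym decrease) (shift (p T) (ℤ.+ k)) x≤))
      where
      shift : ∀ a b → a + (1ℤ + b) ≡ (a + b) + 1ℤ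
      shift = solve-∀

  blocked-point : ∀ x → Base p x → InBox f g x → ∃[ m ] Base p m × InBox f g m × Blocked p f g T m
  -- The initial gap x(T) - p(T) is nonnegative, so its absolute value is a valid natural bound.
  blocked-point x base box = blocked-below ℤ.∣ x ⟨ T ⟩ ℤ.- p T ∣ x base box
    (ℤ.≤-reflexive (trans (split (x ⟨ T ⟩) (p T))
      (cong (p T +_) (sym (ℤ.0≤i⇒+∣i∣≡i (ℤ.i≤j⇒0≤j-i (proj₂ base T)))))))
    where
    split : ∀ a b → a ≡ b + (a + - b)
    split = solve-∀

-- Assembling a single tight separating set

-- Each `R i`, once obtained, survives combination on either side, so one witness per index can be
-- folded into a common one. It is applied with intersection over `t` and then with union over `s`.
accumulate : ∀ {A : Set} (_∙_ : A → A → A) (P : A → Set) (R : Fin k → A → Set) (e : A) →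
             P e → (∀ {a b} → P a → P b → P (a ∙ b)) →
             (∀ i {a b} → R i a → R i (a ∙ b)) → (∀ i {a b} → R i b → R i (a ∙ b)) →
             (∀ i → ∃[ a ] P a × R i a) → ∃[ a ] P a × (∀ i → R i a)
accumulate {zero} _∙_ P R e Pe P∙ Rˡ Rʳ each = e , Pe , λ ()
accumulate {suc k} _∙_ P R e Pe P∙ Rˡ Rʳ each =
  let a , Pa , R₀a = each zero
      b , Pb , Rb  = accumulate _∙_ P (R ∘ suc) e Pe P∙ (Rˡ ∘ suc) (Rʳ ∘ suc) (each ∘ suc)
  in a ∙ b , P∙ Pa Pb , λ { zero → Rˡ zero R₀a ; (suc i) → Rʳ (suc i) (Rb i) }

-- For fixed `s`, intersecting the separators over all raisable `t` gives a tight set that contains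
-- `s` and avoids every such `t`. The union of these sets over `s` still avoids them all.
separating-set : ∀ {p : Subset n → ℤ} {f g T x} → FullySupermodular p → p ⊥ ≡ 0ℤ → Base p x →
                 Blocked p f g T x →
                 ∃[ X ] Tight p x X × (∀ s → Lowerable T f x s → lookup X s ≡ true)
                                    × (∀ t → Raisable T g x t → lookup X t ≡ false)
separating-set {n} {p} {f} {g} {T} {x} super p⊥≡0 base blocked =
  let X , (tight , avoids) , contains = union in X , tight , contains , avoids
  where
  Avoids : Subset n → Set
  Avoids Z = ∀ t → Raisable T g x t → lookup Z t ≡ false

  intersection : ∀ s → Lowerable T f x s → ∃[ Z ] (Tight p x Z × lookup Z s ≡ true) × Avoids Z
  intersection s ls = accumulate _∩ₛ_ (λ Z → Tight p x Z × lookup Z s ≡ true)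
    (λ t Z → Raisable T g x t → lookup Z t ≡ false) ⊤
    (proj₁ base , lookup-replicate s true)
    (λ {X} {Y} (tX , sX) (tY , sY) → proj₁ (tight-lattice super base tX tY)
      , trans (lookup-zipWith _∧_ s X Y) (cong₂ _∧_ sX sY))
    (λ t {X} {Y} X∌t rt → trans (lookup-zipWith _∧_ t X Y) (cong (_∧ lookup Y t) (X∌t rt)))
    (λ t {X} {Y} Y∌t rt → trans (lookup-zipWith _∧_ t X Y)
      (trans (cong (lookup X t ∧_) (Y∌t rt)) (Bool.∧-zeroʳ _)))
    separator
    where
    separator : ∀ t → ∃[ Z ] (Tight p x Z × lookup Z s ≡ true) × (Raisable T g x t → lookup Z t ≡ false)
    separator t with raisable? T g x t
    ... | yes rt = let Z , tight , Z∋s , Z∌t = blocked s t ls rt in Z , (tight , Z∋s) , λ _ → Z∌t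
    -- Where nothing has to be avoided, the neutral set `⊤` serves; it is tight because x(V) = p(V).
    ... | no ¬rt = ⊤ , (proj₁ base , lookup-replicate s true) , λ rt → ⊥-elim (¬rt rt)

  -- The empty union, also the default when `s` is not lowerable, is tight because `p ⊥ ≡ 0ℤ`.
  tight⊥ : Tight p x ⊥
  tight⊥ = trans (⟨⊥⟩ x) (sym p⊥≡0)

  union : ∃[ Z ] (Tight p x Z × Avoids Z) × (∀ s → Lowerable T f x s → lookup Z s ≡ true)
  union = accumulate _∪ₛ_ (λ Z → Tight p x Z × Avoids Z)
    (λ s Z → Lowerable T f x s → lookup Z s ≡ true) ⊥
    (tight⊥ , λ t _ → lookup-replicate t false)
    (λ {X} {Y} (tX , aX) (tY , aY) → proj₂ (tight-lattice super base tX tY)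
      , λ t rt → trans (lookup-zipWith _∨_ t X Y) (cong₂ _∨_ (aX t rt) (aY t rt)))
    (λ s {X} {Y} X∋s ls → trans (lookup-zipWith _∨_ s X Y) (cong (_∨ lookup Y s) (X∋s ls)))
    (λ s {X} {Y} Y∋s ls → trans (lookup-zipWith _∨_ s X Y)
      (trans (cong (lookup X s ∨_) (Y∋s ls)) (Bool.∨-zeroʳ _)))
    container
    where
    container : ∀ s → ∃[ Z ] (Tight p x Z × Avoids Z) × (Lowerable T f x s → lookup Z s ≡ true)
    container s with lowerable? T f x s
    ... | yes ls = let Z , (tight , Z∋s) , avoids = intersection s ls in Z , (tight , avoids) , λ _ → Z∋s
    ... | no ¬ls = ⊥ , (tight⊥ , λ t _ → lookup-replicate t false) , λ ls → ⊥-elim (¬ls ls)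

-- Duality

-- In the next three definitions the Booleans say whether v ∈ T and v ∈ X.
surplus lower upper : (inT inX : Bool) (f g : ℤ) → ℤ
surplus true  false f g = f
surplus false true  f g = - g
surplus _     _     f g = 0ℤ
lower false true f g = g
lower _     _    f g = f
upper true false f g = f
upper _    _     f g = g

if₀ : Bool → ℤ → ℤ
if₀ b y = if b then y else 0ℤ

-- Weak duality at one coordinate: `f ≤ y` is needed in `T` outside `X`, and `y ≤ g` in `X` outside
-- `T`.
surplus-bound : ∀ b c {f g y} → f ≤ y → y ≤ g → if₀ c y + surplus b c f g ≤ if₀ b y
surplus-bound true  true  _ _ = ℤ.≤-reflexive (ℤ.+-identityʳ _)
surplus-bound true  false {f} f≤y _ = subst (ℤ._≤ _) (sym (ℤ.+-identityˡ f)) f≤y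
surplus-bound false true  _ y≤g = ℤ.i≤j⇒i-j≤0 y≤g
surplus-bound false false _ _ = ℤ.≤-refl

-- In the two mixed cases equality pins `y` to `f` or to `g`, which closes the interval from `lower`
-- to `upper` to one point.
surplus-attained⇒ : ∀ b c {f g y} → f ≤ y → y ≤ g → if₀ b y ≤ if₀ c y + surplus b c f g →
                    lower b c f g ≤ y × y ≤ upper b c f g
surplus-attained⇒ true  true  f≤y y≤g _ = f≤y , y≤g
surplus-attained⇒ true  false {f} f≤y y≤g attained = f≤y , subst (_ ℤ.≤_) (ℤ.+-identityˡ f) attained
surplus-attained⇒ false true  f≤y y≤g attained = ℤ.0≤i-j⇒j≤i attained , y≤g
surplus-attained⇒ false false f≤y y≤g _ = f≤y , y≤g

surplus-attained⇐ : ∀ b c {f g y} → lower b c f g ≤ y → y ≤ upper b c f g →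
                    if₀ b y ≤ if₀ c y + surplus b c f g
surplus-attained⇐ true  true  _ _ = ℤ.≤-reflexive (sym (ℤ.+-identityʳ _))
surplus-attained⇐ true  false {f} _ y≤f = subst (_ ℤ.≤_) (sym (ℤ.+-identityˡ f)) y≤f
surplus-attained⇐ false true  g≤y _ = ℤ.i≤j⇒0≤j-i g≤y
surplus-attained⇐ false false _ _ = ℤ.≤-refl

lower≥ : ∀ b c {f g} → f ≤ g → f ≤ lower b c f g
lower≥ true  _     _   = ℤ.≤-refl
lower≥ false true  f≤g = f≤g
lower≥ false false _   = ℤ.≤-refl

upper≤ : ∀ b c {f g} → f ≤ g → upper b c f g ≤ g
upper≤ true  true  _   = ℤ.≤-refl
upper≤ true  false f≤g = f≤g
upper≤ false _     _   = ℤ.≤-refl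

module Dual (p : Subset n → ℤ) (f g : Fin n → ℤ) (T X : Subset n) where

  -- Complementary slackness as a box: coordinates in `X` outside `T` are fixed at `g`, those in `T`
  -- outside `X` at `f`, and the others keep their bounds.
  f′ g′ excess : Fin n → ℤ
  f′ v     = lower (lookup T v) (lookup X v) (f v) (g v)
  g′ v     = upper (lookup T v) (lookup X v) (f v) (g v)
  excess v = surplus (lookup T v) (lookup X v) (f v) (g v)

  -- The objective value of the linear programming dual solution that puts weight one on the single
  -- set `X`.
  dual : ℤ
  dual = p X + sum excess

  private
    Σ-split : ∀ y → sum (λ v → restrict y X v + excess v) ≡ y ⟨ X ⟩ + sum excess
    Σ-split y = ∑-distrib-+ (restrict y X) excess

    pointwise : ∀ {y} → InBox f g y → ∀ v → restrict y X v + excess v ≤ restrict y T v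
    pointwise box v = surplus-bound (lookup T v) (lookup X v) (proj₁ (box v)) (proj₂ (box v))

    partial-bound : ∀ {y} → InBox f g y → y ⟨ X ⟩ + sum excess ≤ y ⟨ T ⟩
    partial-bound {y} box = subst (ℤ._≤ _) (Σ-split y) (sum-mono (pointwise box))

  dual-bound : ∀ {y} → Base p y → InBox f g y → dual ≤ y ⟨ T ⟩
  dual-bound (_ , p≤y) box = ℤ.≤-trans (ℤ.+-monoˡ-≤ (sum excess) (p≤y X)) (partial-bound box)

  -- The bound adds p(X) ≤ y(X) to one inequality per coordinate. If the total is attained, none of
  -- them can be strict.
  attained⇒ : ∀ {y} → Base p y → InBox f g y → y ⟨ T ⟩ ≤ dual → Tight p y X × InBox f′ g′ y
  attained⇒ {y} (_ , p≤y) box yT≤dual =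
      ℤ.≤-antisym (+-cancelʳ-≤ (sum excess) _ _ (ℤ.≤-trans (partial-bound box) yT≤dual)) (p≤y X)
    , λ v → surplus-attained⇒ (lookup T v) (lookup X v) (proj₁ (box v)) (proj₂ (box v))
        (sum-mono-squeeze (pointwise box) yT≤ v)
    where
    yT≤ : y ⟨ T ⟩ ≤ sum (λ v → restrict y X v + excess v)
    yT≤ = ℤ.≤-trans yT≤dual
      (subst (_ ℤ.≤_) (sym (Σ-split y)) (ℤ.+-monoˡ-≤ (sum excess) (p≤y X)))

  attained⇐ : ∀ {y} → Tight p y X → InBox f′ g′ y → y ⟨ T ⟩ ≤ dual
  attained⇐ {y} tight box = subst (_ ℤ.≤_) (trans (Σ-split y) (cong (_+ sum excess) tight))
    (sum-mono λ v → surplus-attained⇐ (lookup T v) (lookup X v) (proj₁ (box v)) (proj₂ (box v)))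

  -- A coordinate in `T` outside `X` is not lowerable, so it equals `f`; one in `X` outside `T` is
  -- not raisable, so it equals `g`.
  separating-attains : ∀ {x} → Tight p x X → InBox f g x →
                       (∀ s → Lowerable T f x s → lookup X s ≡ true) →
                       (∀ t → Raisable T g x t → lookup X t ≡ false) → x ⟨ T ⟩ ≤ dual
  separating-attains {x} tight box contains avoids = attained⇐ tight box′
    where
    true≢false : true ≢ false
    true≢false ()
    box′ : InBox f′ g′ x
    box′ v with lookup T v in Tv | lookup X v in Xv
    ... | true  | true  = box v
    ... | false | false = box v
    ... | true  | false = proj₁ (box v) , ℤ.≮⇒≥ λ f<x → true≢false (trans (sym (contains v (Tv , f<x))) Xv)
    ... | false | true  = ℤ.≮⇒≥ (λ x<g → true≢false (trans (sym Xv) (avoids v (Tv , x<g)))) , proj₂ (box v)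

-- Transfer to ℚ

-- For a variable `z` the quotient `z ℚ./ 1` is stuck on normalization; this form exposes the
-- numerator and the denominator 1.
ι-mkℚ : ∀ z → ι z ≡ mkℚ z 0 (Coprime.sym (1-coprimeTo ℤ.∣ z ∣))
ι-mkℚ z = ℚ.↥p/↧p≡p (mkℚ z 0 (Coprime.sym (1-coprimeTo ℤ.∣ z ∣)))

ι-mono : ∀ {a b} → a ≤ b → ι a ℚ.≤ ι b
ι-mono {a} {b} a≤b rewrite ι-mkℚ a | ι-mkℚ b = ℚ.*≤* (ℤ.*-monoʳ-≤-nonNeg 1ℤ a≤b)

ι-cancel : ∀ {a b} → ι a ℚ.≤ ι b → a ≤ b
ι-cancel {a} {b} ιa≤ιb rewrite ι-mkℚ a | ι-mkℚ b =
  subst₂ ℤ._≤_ (ℤ.*-identityʳ a) (ℤ.*-identityʳ b) (ℚ.drop-*≤* ιa≤ιb)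

ι-injective : ∀ {a b} → ι a ≡ ι b → a ≡ b
ι-injective eq = ℤ.≤-antisym (ι-cancel (ℚ.≤-reflexive eq)) (ι-cancel (ℚ.≤-reflexive (sym eq)))

ι-+ : ∀ a b → ι (a + b) ≡ ι a ℚ.+ ι b
ι-+ a b rewrite ι-mkℚ a | ι-mkℚ b =
  -- With both denominators exposed, the rational sum unfolds to (a · 1 + b · 1) / 1.
  cong ι (sym (cong₂ _+_ (ℤ.*-identityʳ a) (ℤ.*-identityʳ b)))

ι-sum : ∀ (a : Fin n → ℤ) → ι (sum a) ≡ ℚΣ.sum (ι ∘ a)
ι-sum {zero}  a = refl
ι-sum {suc n} a = trans (ι-+ (a zero) (sum (a ∘ suc))) (cong (ι (a zero) ℚ.+_) (ι-sum (a ∘ suc)))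

module Integral (x : Point n) (x∈ℤ : x ∈ ℤ^V) where

  coordinates : Fin n → ℤ
  coordinates v = proj₁ (x∈ℤ v)

  ~-⟨⟩ : ∀ Z → x ~ Z ≡ ι (coordinates ⟨ Z ⟩)
  ~-⟨⟩ Z = trans (ℚΣ.sum-cong-≗ pointwise) (sym (ι-sum (restrict coordinates Z)))
    where
    pointwise : ∀ v → (if lookup Z v then x v else 0ℚ) ≡ ι (restrict coordinates Z v)
    pointwise v with lookup Z v
    ... | true  = proj₂ (x∈ℤ v)
    ... | false = refl

  B′⇒Base : ∀ {p} → B′ p x → Base p coordinates
  B′⇒Base (total , p≤x) =
      ι-injective (trans (sym (~-⟨⟩ ⊤)) total)
    , λ Z → ι-cancel (subst (_ ℚ.≤_) (~-⟨⟩ Z) (p≤x Z))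

  Base⇒B′ : ∀ {p} → Base p coordinates → B′ p x
  Base⇒B′ (total , p≤x) =
      trans (~-⟨⟩ ⊤) (cong ι total)
    , λ Z → subst (_ ℚ.≤_) (sym (~-⟨⟩ Z)) (ι-mono (p≤x Z))

  Box⇒InBox : ∀ {f g} → Box f g x → InBox f g coordinates
  Box⇒InBox box v = ι-cancel (subst (_ ℚ.≤_) (proj₂ (x∈ℤ v)) (proj₁ (box v)))
                  , ι-cancel (subst (ℚ._≤ _) (proj₂ (x∈ℤ v)) (proj₂ (box v)))

  InBox⇒Box : ∀ {f g} → InBox f g coordinates → Box f g x
  InBox⇒Box box v = subst (_ ℚ.≤_) (sym (proj₂ (x∈ℤ v))) (ι-mono (proj₁ (box v)))
                  , subst (ℚ._≤ _) (sym (proj₂ (x∈ℤ v))) (ι-mono (proj₂ (box v)))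

theorem5p10 :
    (n : ℕ) (p : Subset n → ℤ) (f g : Fin n → ℤ) →
    FullySupermodular p →
    p ⊥ ≡ 0ℤ →
    (∀ v → f v ≤ g v) →
    let B = B′ p
        B□ = B ∩ Box f g
    in
    Satisfiable (B□ ∩ ℤ^V) →
    (T : Subset n) →
    ∃[ f′ ] ∃[ g′ ] ∃[ X ]
      (Box f′ g′ ⊆ Box f g) ×
      (∀ m → m ∈ B□ ∩ ℤ^V →
        (Minimizes (_~ T) (B□ ∩ ℤ^V) m ⇔
          ((m ~ X ≡ ι (p X)) × (m ∈ B ∩ ℤ^V ∩ Box f′ g′))))
theorem5p10 n p f g super p⊥≡0 f≤g (x₀ , (x₀∈B , x₀∈Box) , x₀∈ℤ) T =
  f′ , g′ , X , subbox , λ m m∈ → mk⇔ (minimizes⇒ m m∈) (minimizes⇐ m m∈)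
  where
  module x₀ = Integral x₀ x₀∈ℤ
  -- The given integral point only seeds the descent. Both `X` and the new box come from its end
  -- point `z`, so they do not depend on `m`.
  start = blocked-point p f g T x₀.coordinates (x₀.B′⇒Base x₀∈B) (x₀.Box⇒InBox x₀∈Box)
  z = proj₁ start
  z-base : Base p z
  z-base = proj₁ (proj₂ start)
  z-box : InBox f g z
  z-box = proj₁ (proj₂ (proj₂ start))
  separating = separating-set {f = f} {g} {T} super p⊥≡0 z-base (proj₂ (proj₂ (proj₂ start)))
  X = proj₁ separating
  open Dual p f g T X

  -- Together with `dual-bound` this makes `dual` the exact minimum, attained at `z`.
  zT≤dual : z ⟨ T ⟩ ≤ dual
  zT≤dual = let tight , contains , avoids = proj₂ separating in separating-attains tight z-box contains avoids

  subbox : Box f′ g′ ⊆ Box f g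
  subbox box v =
      ℚ.≤-trans (ι-mono (lower≥ (lookup T v) (lookup X v) (f≤g v))) (proj₁ (box v))
    , ℚ.≤-trans (proj₂ (box v)) (ι-mono (upper≤ (lookup T v) (lookup X v) (f≤g v)))

  minimizes⇒ : ∀ m → m ∈ (B′ p ∩ Box f g) ∩ ℤ^V → Minimizes (_~ T) ((B′ p ∩ Box f g) ∩ ℤ^V) m →
               (m ~ X ≡ ι (p X)) × (m ∈ B′ p ∩ ℤ^V ∩ Box f′ g′)
  minimizes⇒ m ((m∈B , m∈Box) , m∈ℤ) (_ , minimal) =
    trans (m.~-⟨⟩ X) (cong ι (proj₁ attained)) , m∈B , m∈ℤ , m.InBox⇒Box (proj₂ attained)
    where
    module m  = Integral m m∈ℤ
    module ιz = Integral (ι ∘ z) (λ v → z v , refl)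
    m≤z : m ~ T ℚ.≤ (ι ∘ z) ~ T
    -- Comparing a minimizer with `z` is enough: m(T) ≤ z(T) ≤ `dual` forces every slackness
    -- condition.
    m≤z = minimal (ι ∘ z) ((ιz.Base⇒B′ z-base , ιz.InBox⇒Box z-box) , λ v → z v , refl)
    attained : Tight p m.coordinates X × InBox f′ g′ m.coordinates
    attained = attained⇒ (m.B′⇒Base m∈B) (m.Box⇒InBox m∈Box)
      (ℤ.≤-trans (ι-cancel (subst₂ ℚ._≤_ (m.~-⟨⟩ T) (ιz.~-⟨⟩ T) m≤z)) zT≤dual)

  minimizes⇐ : ∀ m → m ∈ (B′ p ∩ Box f g) ∩ ℤ^V →
               (m ~ X ≡ ι (p X)) × (m ∈ B′ p ∩ ℤ^V ∩ Box f′ g′) →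
               Minimizes (_~ T) ((B′ p ∩ Box f g) ∩ ℤ^V) m
  minimizes⇐ m m∈@(_ , m∈ℤ) (mX≡pX , _ , _ , m∈Box′) = m∈ , minimal
    where
    module m = Integral m m∈ℤ
    minimal : ∀ y → y ∈ (B′ p ∩ Box f g) ∩ ℤ^V → m ~ T ℚ.≤ y ~ T
    minimal y ((y∈B , y∈Box) , y∈ℤ) =
      -- Over the integers the chain is m(T) ≤ `dual` ≤ y(T).
      subst₂ ℚ._≤_ (sym (m.~-⟨⟩ T)) (sym (y.~-⟨⟩ T)) (ι-mono (ℤ.≤-trans
        (attained⇐ (ι-injective (trans (sym (m.~-⟨⟩ X)) mX≡pX)) (m.Box⇒InBox m∈Box′))
        (dual-bound (y.B′⇒Base y∈B) (y.Box⇒InBox y∈Box))))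
      where
      module y = Integral y y∈ℤ
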